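{- There exists a countable $\beta$-model $M$ such that for every $X \in M$: if $X$ is definable in $M$, then $X \in \mathrm{HYP}$.
   Context: An $\omega$-model is a structure for the language of second order arithmetic whose first order part is the standard natural numbers $\omega$; it is identified with its collection $M \subseteq \mathcal{P}(\omega)$ of sets. A $\beta$-model is an $\omega$-model $M$ such that for every $\Sigma^1_1$ sentence $\varphi$ with parameters from $M$, $\varphi$ is true if and only if $M \models \varphi$. $\mathrm{HYP}$ denotes the set of hyperarithmetical subsets of $\omega$. A set $X \in M$ is definable in $M$ if there is a formula $\varphi(X)$ of second order arithmetic with $X$ as its only free variable (and no parameters) such that $M \models (\exists \text{ exactly one } X)\,\varphi(X)$ and $M\models\varphi(X)$ for this $X$. -}

module Defs where

open import Data.Nat using (ℕ; zero; suc; _+_; _*_; _<_)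
open import Data.Fin using (Fin)
open import Data.Bool using (Bool; true)
open import Data.Product using (Σ; _×_; _,_)
open import Data.Sum using (_⊎_)
open import Data.Empty using (⊥)
open import Data.Vec.Functional using (Vector; []; _∷_)
open import Relation.Binary.PropositionalEquality using (_≡_)

Subset : Set
Subset = ℕ → Bool

_∈ₛ_ : ℕ → Subset → Set
n ∈ₛ X = X n ≡ true

_≐_ : Subset → Subset → Set
X ≐ Y = ∀ n → X n ≡ Y n

_⇔_ : Set → Set → Set
A ⇔ B = (A → B) × (B → A)

-- Syntax of the language L₂ of second order arithmetic.
-- De Bruijn indices: Formula n k has n free number variables and
-- k free set variables.

data Term (n : ℕ) : Set where
  var  : Fin n → Term n
  zro  : Term n
  one  : Term n
  _⊕_  : Term n → Term n → Term n
  _⊗_  : Term n → Term n → Term n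

data Formula (n k : ℕ) : Set where
  _≈_   : Term n → Term n → Formula n k
  _≺_   : Term n → Term n → Formula n k
  _∈'_  : Term n → Fin k → Formula n k
  ¬'_   : Formula n k → Formula n k
  _∧'_  : Formula n k → Formula n k → Formula n k
  _∨'_  : Formula n k → Formula n k → Formula n k
  _⇒'_  : Formula n k → Formula n k → Formula n k
  ∀ⁿ    : Formula (suc n) k → Formula n k
  ∃ⁿ    : Formula (suc n) k → Formula n k
  ∀ˢ    : Formula n (suc k) → Formula n k
  ∃ˢ    : Formula n (suc k) → Formula n k

data Arith {n k : ℕ} : Formula n k → Set where
  a≈ : ∀ t s → Arith (t ≈ s)
  a≺ : ∀ t s → Arith (t ≺ s)
  a∈ : ∀ t X → Arith (t ∈' X)
  a¬ : ∀ {φ} → Arith φ → Arith (¬' φ)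
  a∧ : ∀ {φ ψ} → Arith φ → Arith ψ → Arith (φ ∧' ψ)
  a∨ : ∀ {φ ψ} → Arith φ → Arith ψ → Arith (φ ∨' ψ)
  a⇒ : ∀ {φ ψ} → Arith φ → Arith ψ → Arith (φ ⇒' ψ)
  a∀ : ∀ {φ} → Arith φ → Arith (∀ⁿ φ)
  a∃ : ∀ {φ} → Arith φ → Arith (∃ⁿ φ)

data Σ¹₁ {n : ℕ} : {k : ℕ} → Formula n k → Set where
  σ-arith : ∀ {k} {φ : Formula n k} → Arith φ → Σ¹₁ φ
  σ-∃     : ∀ {k} {φ : Formula n (suc k)} → Σ¹₁ φ → Σ¹₁ (∃ˢ φ)

data Π¹₁ {n : ℕ} : {k : ℕ} → Formula n k → Set where
  π-arith : ∀ {k} {φ : Formula n k} → Arith φ → Π¹₁ φ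
  π-∀     : ∀ {k} {φ : Formula n (suc k)} → Π¹₁ φ → Π¹₁ (∀ˢ φ)

-- Semantics in an ω-model.  The second order part is given by an
-- index type I together with el : I → Subset (the model is the image
-- of el).  The first order part is always the standard ℕ.

evalT : ∀ {n} → Term n → Vector ℕ n → ℕ
evalT (var i) ρ = ρ i
evalT zro     ρ = 0
evalT one     ρ = 1
evalT (t ⊕ s) ρ = evalT t ρ + evalT s ρ
evalT (t ⊗ s) ρ = evalT t ρ * evalT s ρ

Sat : (I : Set) (el : I → Subset) {n k : ℕ} →
      Formula n k → Vector ℕ n → Vector Subset k → Set
Sat I el (t ≈ s)  ρ σ = evalT t ρ ≡ evalT s ρ
Sat I el (t ≺ s)  ρ σ = evalT t ρ < evalT s ρ
Sat I el (t ∈' X) ρ σ = evalT t ρ ∈ₛ σ X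
Sat I el (¬' φ)   ρ σ = Sat I el φ ρ σ → ⊥
Sat I el (φ ∧' ψ) ρ σ = Sat I el φ ρ σ × Sat I el ψ ρ σ
Sat I el (φ ∨' ψ) ρ σ = Sat I el φ ρ σ ⊎ Sat I el ψ ρ σ
Sat I el (φ ⇒' ψ) ρ σ = Sat I el φ ρ σ → Sat I el ψ ρ σ
Sat I el (∀ⁿ φ)   ρ σ = (m : ℕ) → Sat I el φ (m ∷ ρ) σ
Sat I el (∃ⁿ φ)   ρ σ = Σ ℕ λ m → Sat I el φ (m ∷ ρ) σ
Sat I el (∀ˢ φ)   ρ σ = (i : I) → Sat I el φ ρ (el i ∷ σ)
Sat I el (∃ˢ φ)   ρ σ = Σ I λ i → Sat I el φ ρ (el i ∷ σ)

True : {n k : ℕ} → Formula n k → Vector ℕ n → Vector Subset k → Set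
True = Sat Subset (λ X → X)

-- A countable ω-model, given by an enumeration M : ℕ → Subset of its
-- members (so M = { M i | i ∈ ℕ }).
CountableModel : Set
CountableModel = ℕ → Subset

_⊨_[_] : CountableModel → {k : ℕ} → Formula 0 k → Vector Subset k → Set
M ⊨ φ [ σ ] = Sat ℕ M φ [] σ

IsβModel : CountableModel → Set
IsβModel M = ∀ {k} (φ : Formula 0 k) → Σ¹₁ φ → (ps : Fin k → ℕ) →
             True φ [] (λ j → M (ps j)) ⇔ (M ⊨ φ [ (λ j → M (ps j)) ])

-- X (a member of M) is definable in M: some parameter-free formula
-- φ(X) with X as its only free variable satisfies
-- M ⊨ ∃!X φ(X) and M ⊨ φ(X).
DefinableIn : CountableModel → Subset → Set
DefinableIn M X =
  Σ (Formula 0 1) λ φ →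
    (M ⊨ φ [ X ∷ [] ]) ×
    (∀ j → M ⊨ φ [ M j ∷ [] ] → M j ≐ X)

-- HYP: the hyperarithmetical sets = the (lightface) Δ¹₁ sets, i.e.
-- definable over the standard structure both by a parameter-free Σ¹₁
-- and by a parameter-free Π¹₁ formula with one free number variable.
HYP : Subset → Set
HYP X =
  (Σ (Formula 1 0) λ φ → Σ¹₁ φ × (∀ m → (m ∈ₛ X) ⇔ True φ (m ∷ []) [])) ×
  (Σ (Formula 1 0) λ ψ → Π¹₁ ψ × (∀ m → (m ∈ₛ X) ⇔ True ψ (m ∷ []) []))

module Submission where

-- M is the range of a generic sequence of sets.  A condition is a finite list of
-- arithmetical requirements on the members of the sequence that some actual sequence of sets
-- meets.  If a Σ¹₁ formula holds of the generic sets, it can be forced by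
-- using an unused name for the witness, so M is a β-model.
--
-- Suppose φ defines the set named i in M, as forced by p.  If two sequences meeting p
-- disagree on their i-th set, amalgamate p with a copy πp in which all names are replaced by
-- fresh ones.  By symmetry this forces φ of both i and πi, and it is consistent that the
-- two sets differ, so genericity contradicts uniqueness.  Hence some condition p in the generic
-- filter determines the set, and quantifying over the sequences meeting p, existentially or
-- universally, gives its Σ¹₁ and Π¹₁ definitions.

open import Defs
open import Level using (0ℓ)
open import Data.Bool.Base using (true; false)
open import Data.Empty using (⊥-elim)
open import Data.Fin.Base using (Fin; zero; suc; toℕ)
open import Data.Fin.Properties using (toℕ-fromℕ<)
open import Data.List.Base as List
  using (List; []; _∷_; _++_; concat; concatMap; cartesianProductWith; upTo; allFin)
open import Data.List.Membership.Propositional using (_∈_; lose)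
open import Data.List.Membership.Propositional.Properties
  using (∈-map⁺; ∈-concat⁺′; ∈-concatMap⁺; ∈-cartesianProductWith⁺; ∈-upTo⁺; ∈-allFin; ∈-++⁺ˡ; ∈-++⁺ʳ)
open import Data.List.Relation.Unary.All as All using (All; []; _∷_)
import Data.List.Relation.Unary.All.Properties as All
open import Data.List.Relation.Unary.Any using (here; there)
open import Data.Nat.Base using (ℕ; zero; suc; _+_; _*_; _∸_; _<_; _≤_; _⊔_; s≤s; _≤′_; ≤′-reflexive; ≤′-step)
open import Data.Nat.DivMod using (_mod_; m<n⇒m%n≡m)
open import Data.Nat.Properties
open import Data.Product using (Σ; _×_; _,_; proj₁; proj₂)
open import Data.Sum.Base using (_⊎_; inj₁; inj₂)
import Data.Sum.Base as Sum
open import Data.Unit.Base using (tt)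
open import Data.Vec.Base as Vec using (Vec; []; _∷_)
import Data.Vec.Properties as Vec
open import Data.Vec.Functional using (Vector) renaming ([] to []ᵛ; _∷_ to _∷ᵛ_)
import Data.Vec.Relation.Unary.All as VecAll
open import Function.Base using (_∘_; id)
open import Relation.Binary.PropositionalEquality
open import Relation.Nullary using (Dec; yes; no; does; ¬_)
open import Relation.Nullary.Decidable using (decidable-stable)
open import Axiom.ExcludedMiddle using (ExcludedMiddle)

private variable
  A B : Set
  m n k l : ℕ

-- Unlike Vec.lookup, toVector commutes definitionally with the environment extension in Sat.
toVector : Vec A n → Vector A n
toVector []      = []ᵛ
toVector (x ∷ v) = x ∷ᵛ toVector v

toVector-lookup : (v : Vec A n) (i : Fin n) → toVector v i ≡ Vec.lookup v i
toVector-lookup (x ∷ v) zero    = refl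
toVector-lookup (x ∷ v) (suc i) = toVector-lookup v i

-- Sequences of sets and the environments read off from them

Sequence : Set
Sequence = ℕ → Subset

env : Sequence → Vec ℕ k → Vector Subset k
env X v = toVector (Vec.map X v)

env-lookup : ∀ X (v : Vec ℕ k) i → env X v i ≡ X (Vec.lookup v i)
env-lookup X v i = trans (toVector-lookup (Vec.map X v) i) (Vec.lookup-map i X v)

BoundedBy : ℕ → Vec ℕ k → Set
BoundedBy K = VecAll.All (_< K)

BoundedBy-mono : ∀ {K L} {v : Vec ℕ k} → K ≤ L → BoundedBy K v → BoundedBy L v
BoundedBy-mono K≤L = VecAll.map (λ l<K → <-≤-trans l<K K≤L)

boundedBy : (v : Vec ℕ k) → Σ ℕ λ K → BoundedBy K v
boundedBy []      = 0 , VecAll.[]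
boundedBy (x ∷ v) with boundedBy v
... | K , b = suc x ⊔ K , m≤m⊔n (suc x) K VecAll.∷ BoundedBy-mono (m≤n⊔m (suc x) K) b

_≈[_]_ : Sequence → ℕ → Sequence → Set
X ≈[ K ] Y = ∀ {l} → l < K → X l ≡ Y l

map-cong-bounded : ∀ {X Y : Sequence} {K} {v : Vec ℕ k} →
                   BoundedBy K v → X ≈[ K ] Y → Vec.map X v ≡ Vec.map Y v
map-cong-bounded VecAll.[]        eq = refl
map-cong-bounded (l<K VecAll.∷ b) eq = cong₂ _∷_ (eq l<K) (map-cong-bounded b eq)

-- Vectors with equal entries are equal, while for functions this would need extensionality.
-- Environments computed from vectors are thus equal outright, and `True` can be transported along
-- the equality.
env-cong-bounded : ∀ {X Y : Sequence} {K} {v : Vec ℕ k} →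
                   BoundedBy K v → X ≈[ K ] Y → env X v ≡ env Y v
env-cong-bounded b eq = cong toVector (map-cong-bounded b eq)

-- Satisfaction

Sat-resp : (I : Set) (el : I → Subset) (φ : Formula n k)
           {ρ : Vector ℕ n} {σ σ′ : Vector Subset k} →
           (∀ j → σ j ≡ σ′ j) → Sat I el φ ρ σ → Sat I el φ ρ σ′
Sat-resp I el (t ≈ s)  eq h = h
Sat-resp I el (t ≺ s)  eq h = h
Sat-resp I el (t ∈' X) {ρ} eq h = subst (evalT t ρ ∈ₛ_) (eq X) h
Sat-resp I el (¬' φ)   eq h = h ∘ Sat-resp I el φ (sym ∘ eq)
Sat-resp I el (φ ∧' ψ) eq (h , g) = Sat-resp I el φ eq h , Sat-resp I el ψ eq g
Sat-resp I el (φ ∨' ψ) eq h = Sum.map (Sat-resp I el φ eq) (Sat-resp I el ψ eq) h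
Sat-resp I el (φ ⇒' ψ) eq h = Sat-resp I el ψ eq ∘ h ∘ Sat-resp I el φ (sym ∘ eq)
Sat-resp I el (∀ⁿ φ)   eq h m = Sat-resp I el φ eq (h m)
Sat-resp I el (∃ⁿ φ)   eq (m , h) = m , Sat-resp I el φ eq h
Sat-resp I el (∀ˢ φ)   eq h i = Sat-resp I el φ (λ { zero → refl ; (suc j) → eq j }) (h i)
Sat-resp I el (∃ˢ φ)   eq (i , h) = i , Sat-resp I el φ (λ { zero → refl ; (suc j) → eq j }) h

-- Without set quantifiers `el` is never consulted. The two models play symmetric roles, so the
-- hypotheses of `¬'` and `⇒'` can be carried back the other way.
arith-absolute : {I J : Set} {elI : I → Subset} {elJ : J → Subset}
                 {φ : Formula n k} {ρ : Vector ℕ n} {σ : Vector Subset k} →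
                 Arith φ → Sat I elI φ ρ σ → Sat J elJ φ ρ σ
arith-absolute (a≈ t s) h = h
arith-absolute (a≺ t s) h = h
arith-absolute (a∈ t X) h = h
arith-absolute (a¬ a)   h = h ∘ arith-absolute a
arith-absolute (a∧ a b) (h , g) = arith-absolute a h , arith-absolute b g
arith-absolute (a∨ a b) h = Sum.map (arith-absolute a) (arith-absolute b) h
arith-absolute (a⇒ a b) h = arith-absolute b ∘ h ∘ arith-absolute a
arith-absolute (a∀ a)   h m = arith-absolute a (h m)
arith-absolute (a∃ a)   (m , h) = m , arith-absolute a h

Σ¹₁-upward : {I : Set} {el : I → Subset} {φ : Formula n k} {ρ : Vector ℕ n} {σ : Vector Subset k} →
             Σ¹₁ φ → Sat I el φ ρ σ → True φ ρ σ
Σ¹₁-upward (σ-arith a) h = arith-absolute a h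
Σ¹₁-upward {el = el} (σ-∃ s) (i , h) = el i , Σ¹₁-upward s h

-- Substitution in arithmetical formulas

numeral : ℕ → Term n
numeral zero    = zro
numeral (suc m) = one ⊕ numeral m

evalT-numeral : ∀ m {ρ : Vector ℕ n} → evalT (numeral m) ρ ≡ m
evalT-numeral zero    = refl
evalT-numeral (suc m) = cong suc (evalT-numeral m)

substT : (Fin n → Term m) → Term n → Term m
substT τ (var i) = τ i
substT τ zro     = zro
substT τ one     = one
substT τ (t ⊕ s) = substT τ t ⊕ substT τ s
substT τ (t ⊗ s) = substT τ t ⊗ substT τ s

evalT-substT : ∀ (τ : Fin n → Term m) {ρ : Vector ℕ n} {ρ′ : Vector ℕ m} →
               (∀ i → evalT (τ i) ρ′ ≡ ρ i) → ∀ t → evalT (substT τ t) ρ′ ≡ evalT t ρ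
evalT-substT τ eq (var i) = eq i
evalT-substT τ eq zro     = refl
evalT-substT τ eq one     = refl
evalT-substT τ eq (t ⊕ s) = cong₂ _+_ (evalT-substT τ eq t) (evalT-substT τ eq s)
evalT-substT τ eq (t ⊗ s) = cong₂ _*_ (evalT-substT τ eq t) (evalT-substT τ eq s)

lift : (Fin n → Term m) → Fin (suc n) → Term (suc m)
lift τ zero    = var zero
lift τ (suc i) = substT (var ∘ suc) (τ i)

evalT-lift : ∀ (τ : Fin n → Term m) {ρ : Vector ℕ n} {ρ′ : Vector ℕ m} →
             (∀ i → evalT (τ i) ρ′ ≡ ρ i) →
             ∀ x i → evalT (lift τ i) (x ∷ᵛ ρ′) ≡ (x ∷ᵛ ρ) i
evalT-lift τ eq x zero    = refl
evalT-lift τ eq x (suc i) = trans (evalT-substT (var ∘ suc) (λ _ → refl) (τ i)) (eq i)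

-- Recursion on the derivation of `Arith φ` excludes set quantifiers, so the renaming `r` never has
-- to pass under a set binder.
substitute : (Fin n → Term m) → (Fin k → Fin l) → {φ : Formula n k} → Arith φ → Formula m l
substitute τ r (a≈ t s) = substT τ t ≈ substT τ s
substitute τ r (a≺ t s) = substT τ t ≺ substT τ s
substitute τ r (a∈ t X) = substT τ t ∈' r X
substitute τ r (a¬ a)   = ¬' substitute τ r a
substitute τ r (a∧ a b) = substitute τ r a ∧' substitute τ r b
substitute τ r (a∨ a b) = substitute τ r a ∨' substitute τ r b
substitute τ r (a⇒ a b) = substitute τ r a ⇒' substitute τ r b
substitute τ r (a∀ a)   = ∀ⁿ (substitute (lift τ) r a)
substitute τ r (a∃ a)   = ∃ⁿ (substitute (lift τ) r a)

substitute-arith : ∀ (τ : Fin n → Term m) (r : Fin k → Fin l) {φ : Formula n k} (a : Arith φ) →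
                   Arith (substitute τ r a)
substitute-arith τ r (a≈ t s) = a≈ _ _
substitute-arith τ r (a≺ t s) = a≺ _ _
substitute-arith τ r (a∈ t X) = a∈ _ _
substitute-arith τ r (a¬ a)   = a¬ (substitute-arith τ r a)
substitute-arith τ r (a∧ a b) = a∧ (substitute-arith τ r a) (substitute-arith τ r b)
substitute-arith τ r (a∨ a b) = a∨ (substitute-arith τ r a) (substitute-arith τ r b)
substitute-arith τ r (a⇒ a b) = a⇒ (substitute-arith τ r a) (substitute-arith τ r b)
substitute-arith τ r (a∀ a)   = a∀ (substitute-arith (lift τ) r a)
substitute-arith τ r (a∃ a)   = a∃ (substitute-arith (lift τ) r a)

True-substitute : ∀ (τ : Fin n → Term m) (r : Fin k → Fin l) {φ : Formula n k} (a : Arith φ)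
                  {ρ : Vector ℕ n} {ρ′ : Vector ℕ m} {σ : Vector Subset k} {σ′ : Vector Subset l} →
                  (∀ i → evalT (τ i) ρ′ ≡ ρ i) → (∀ j → σ′ (r j) ≡ σ j) →
                  True (substitute τ r a) ρ′ σ′ ⇔ True φ ρ σ
True-substitute τ r (a≈ t s) eqρ eqσ
  rewrite evalT-substT τ eqρ t | evalT-substT τ eqρ s = id , id
True-substitute τ r (a≺ t s) eqρ eqσ
  rewrite evalT-substT τ eqρ t | evalT-substT τ eqρ s = id , id
True-substitute τ r (a∈ t X) eqρ eqσ
  rewrite evalT-substT τ eqρ t | eqσ X = id , id
True-substitute τ r (a¬ a) eqρ eqσ with True-substitute τ r a eqρ eqσ
... | to , from = (_∘ from) , (_∘ to)
True-substitute τ r (a∧ a b) eqρ eqσ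
  with True-substitute τ r a eqρ eqσ | True-substitute τ r b eqρ eqσ
... | to₁ , from₁ | to₂ , from₂ =
  (λ (h , g) → to₁ h , to₂ g) , (λ (h , g) → from₁ h , from₂ g)
True-substitute τ r (a∨ a b) eqρ eqσ
  with True-substitute τ r a eqρ eqσ | True-substitute τ r b eqρ eqσ
... | to₁ , from₁ | to₂ , from₂ = Sum.map to₁ to₂ , Sum.map from₁ from₂
True-substitute τ r (a⇒ a b) eqρ eqσ
  with True-substitute τ r a eqρ eqσ | True-substitute τ r b eqρ eqσ
... | to₁ , from₁ | to₂ , from₂ = (λ h → to₂ ∘ h ∘ from₁) , (λ h → from₂ ∘ h ∘ to₁)
True-substitute τ r (a∀ a) eqρ eqσ =
  (λ h x → proj₁ (ih x) (h x)) , (λ h x → proj₂ (ih x) (h x))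
  where ih = λ x → True-substitute (lift τ) r a (evalT-lift τ eqρ x) eqσ
True-substitute τ r (a∃ a) eqρ eqσ =
  (λ (x , h) → x , proj₁ (ih x) h) , (λ (x , h) → x , proj₂ (ih x) h)
  where ih = λ x → True-substitute (lift τ) r a (evalT-lift τ eqρ x) eqσ

-- Set quantifier prefixes

∃ˢ* : ∀ k → Formula n k → Formula n 0
∃ˢ* zero    φ = φ
∃ˢ* (suc k) φ = ∃ˢ* k (∃ˢ φ)

∀ˢ* : ∀ k → Formula n k → Formula n 0
∀ˢ* zero    φ = φ
∀ˢ* (suc k) φ = ∀ˢ* k (∀ˢ φ)

∃ˢ*-Σ¹₁ : ∀ k {φ : Formula n k} → Σ¹₁ φ → Σ¹₁ (∃ˢ* k φ)
∃ˢ*-Σ¹₁ zero    s = s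
∃ˢ*-Σ¹₁ (suc k) s = ∃ˢ*-Σ¹₁ k (σ-∃ s)

∀ˢ*-Π¹₁ : ∀ k {φ : Formula n k} → Π¹₁ φ → Π¹₁ (∀ˢ* k φ)
∀ˢ*-Π¹₁ zero    p = p
∀ˢ*-Π¹₁ (suc k) p = ∀ˢ*-Π¹₁ k (π-∀ p)

True-∃ˢ* : ∀ k (φ : Formula n k) {ρ : Vector ℕ n} →
           True (∃ˢ* k φ) ρ []ᵛ ⇔ Σ (Vec Subset k) λ v → True φ ρ (toVector v)
True-∃ˢ* zero    φ = (λ h → [] , h) , (λ { ([] , h) → h })
True-∃ˢ* (suc k) φ =
  (λ h → let v , X , h′ = proj₁ ih h in X ∷ v , h′) , (λ { (X ∷ v , h) → proj₂ ih (v , X , h) })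
  where ih = True-∃ˢ* k (∃ˢ φ)

True-∀ˢ* : ∀ k (φ : Formula n k) {ρ : Vector ℕ n} →
           True (∀ˢ* k φ) ρ []ᵛ ⇔ ((v : Vec Subset k) → True φ ρ (toVector v))
True-∀ˢ* zero    φ = (λ { h [] → h }) , (λ h → h [])
True-∀ˢ* (suc k) φ =
  (λ { h (X ∷ v) → proj₁ ih h v X }) , (λ h → proj₂ ih (λ v X → h (X ∷ v)))
  where ih = True-∀ˢ* k (∀ˢ φ)

-- Countability

Eventually : (ℕ → Set) → Set
Eventually P = Σ ℕ λ N → ∀ d → N ≤ d → P d

always : {P : ℕ → Set} → (∀ d → P d) → Eventually P
always h = 0 , λ d _ → h d

eventually₂ : {P Q R : ℕ → Set} → (∀ {d} → P d → Q d → R d) →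
              Eventually P → Eventually Q → Eventually R
eventually₂ f (M , p) (N , q) =
  M ⊔ N , λ d ≤d → f (p d (≤-trans (m≤m⊔n M N) ≤d)) (q d (≤-trans (m≤n⊔m M N) ≤d))

eventually₁ : {P Q : ℕ → Set} → (∀ {d} → P d → Q d) → Eventually P → Eventually Q
eventually₁ f (M , p) = M , λ d ≤d → f (p d ≤d)

-- Each element is listed at all late enough stages, so two elements share a stage, and products
-- need no pairing function.
record Enumeration (A : Set) : Set where
  field
    upto     : ℕ → List A
    complete : ∀ a → Eventually λ d → a ∈ upto d
open Enumeration

enumℕ : Enumeration ℕ
enumℕ .upto = upTo
enumℕ .complete a = suc a , λ d a<d → ∈-upTo⁺ a<d

enumVec : Enumeration A → ∀ n → Enumeration (Vec A n)
enumVec e zero .upto d = [] ∷ []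
enumVec e zero .complete [] = always λ _ → here refl
enumVec e (suc n) .upto d = cartesianProductWith _∷_ (e .upto d) (enumVec e n .upto d)
enumVec e (suc n) .complete (a ∷ v) =
  eventually₂ (∈-cartesianProductWith⁺ _∷_) (e .complete a) (enumVec e n .complete v)

mutual
  termsOfDepth : ℕ → ∀ n → List (Term n)
  termsOfDepth zero    n = []
  termsOfDepth (suc d) n = concat (termBlocks d n)

  termBlocks : ℕ → ∀ n → List (List (Term n))
  termBlocks d n = List.map var (allFin n)
                 ∷ (zro ∷ one ∷ [])
                 ∷ cartesianProductWith _⊕_ ts ts
                 ∷ cartesianProductWith _⊗_ ts ts
                 ∷ []
    where ts = termsOfDepth d n

∈-termBlocks : ∀ d {n t} {ts : List (Term n)} → t ∈ ts → ts ∈ termBlocks d n → t ∈ termsOfDepth (suc d) n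
∈-termBlocks d = ∈-concat⁺′

afterStep : {P Q : ℕ → Set} → (∀ {d} → P d → Q (suc d)) → Eventually P → Eventually Q
afterStep f (N , p) = suc N , λ { (suc d) (s≤s ≤d) → f (p d ≤d) }

pattern 1st p = here p
pattern 2nd p = there (1st p)
pattern 3rd p = there (2nd p)
pattern 4th p = there (3rd p)
pattern 5th p = there (4th p)
pattern 6th p = there (5th p)
pattern 7th p = there (6th p)
pattern 8th p = there (7th p)
pattern 9th p = there (8th p)
pattern 10th p = there (9th p)
pattern 11th p = there (10th p)

enumTerm : ∀ n → Enumeration (Term n)
enumTerm n .upto d = termsOfDepth d n
enumTerm n .complete = go where
  go : ∀ t → Eventually λ d → t ∈ termsOfDepth d n
  go (var i) = afterStep (λ {d} _ → ∈-termBlocks d (∈-map⁺ var (∈-allFin i)) (1st refl)) (always λ _ → tt)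
  go zro     = afterStep (λ {d} _ → ∈-termBlocks d (1st refl) (2nd refl)) (always λ _ → tt)
  go one     = afterStep (λ {d} _ → ∈-termBlocks d (2nd refl) (2nd refl)) (always λ _ → tt)
  go (t ⊕ s) = afterStep (λ {d} p → ∈-termBlocks d p (3rd refl))
                 (eventually₂ (∈-cartesianProductWith⁺ _⊕_) (go t) (go s))
  go (t ⊗ s) = afterStep (λ {d} p → ∈-termBlocks d p (4th refl))
                 (eventually₂ (∈-cartesianProductWith⁺ _⊗_) (go t) (go s))

mutual
  formulasOfDepth : ℕ → ∀ n k → List (Formula n k)
  formulasOfDepth zero    n k = []
  formulasOfDepth (suc d) n k = concat (formulaBlocks d n k)

  formulaBlocks : ℕ → ∀ n k → List (List (Formula n k))
  formulaBlocks d n k = cartesianProductWith _≈_ ts ts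
                      ∷ cartesianProductWith _≺_ ts ts
                      ∷ cartesianProductWith _∈'_ ts (allFin k)
                      ∷ List.map ¬'_ φs
                      ∷ cartesianProductWith _∧'_ φs φs
                      ∷ cartesianProductWith _∨'_ φs φs
                      ∷ cartesianProductWith _⇒'_ φs φs
                      ∷ List.map ∀ⁿ (formulasOfDepth d (suc n) k)
                      ∷ List.map ∃ⁿ (formulasOfDepth d (suc n) k)
                      ∷ List.map ∀ˢ (formulasOfDepth d n (suc k))
                      ∷ List.map ∃ˢ (formulasOfDepth d n (suc k))
                      ∷ []
    where
    ts = termsOfDepth d n
    φs = formulasOfDepth d n k

∈-formulaBlocks : ∀ d {n k φ} {φs : List (Formula n k)} →
                  φ ∈ φs → φs ∈ formulaBlocks d n k → φ ∈ formulasOfDepth (suc d) n k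
∈-formulaBlocks d = ∈-concat⁺′

enumFormula : ∀ n k → Enumeration (Formula n k)
enumFormula n k .upto d = formulasOfDepth d n k
enumFormula n k .complete = go where
  goT : ∀ {n} (t : Term n) → Eventually λ d → t ∈ termsOfDepth d n
  goT = enumTerm _ .complete
  go : ∀ {n k} (φ : Formula n k) → Eventually λ d → φ ∈ formulasOfDepth d n k
  go (t ≈ s)  = afterStep (λ {d} p → ∈-formulaBlocks d p (1st refl))
                  (eventually₂ (∈-cartesianProductWith⁺ _≈_) (goT t) (goT s))
  go (t ≺ s)  = afterStep (λ {d} p → ∈-formulaBlocks d p (2nd refl))
                  (eventually₂ (∈-cartesianProductWith⁺ _≺_) (goT t) (goT s))
  go (t ∈' X) = afterStep (λ {d} p → ∈-formulaBlocks d (∈-cartesianProductWith⁺ _∈'_ p (∈-allFin X)) (3rd refl)) (goT t)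
  go (¬' φ)   = afterStep (λ {d} p → ∈-formulaBlocks d (∈-map⁺ ¬'_ p) (4th refl)) (go φ)
  go (φ ∧' ψ) = afterStep (λ {d} p → ∈-formulaBlocks d p (5th refl))
                  (eventually₂ (∈-cartesianProductWith⁺ _∧'_) (go φ) (go ψ))
  go (φ ∨' ψ) = afterStep (λ {d} p → ∈-formulaBlocks d p (6th refl))
                  (eventually₂ (∈-cartesianProductWith⁺ _∨'_) (go φ) (go ψ))
  go (φ ⇒' ψ) = afterStep (λ {d} p → ∈-formulaBlocks d p (7th refl))
                  (eventually₂ (∈-cartesianProductWith⁺ _⇒'_) (go φ) (go ψ))
  go (∀ⁿ φ)   = afterStep (λ {d} p → ∈-formulaBlocks d (∈-map⁺ ∀ⁿ p) (8th refl)) (go φ)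
  go (∃ⁿ φ)   = afterStep (λ {d} p → ∈-formulaBlocks d (∈-map⁺ ∃ⁿ p) (9th refl)) (go φ)
  go (∀ˢ φ)   = afterStep (λ {d} p → ∈-formulaBlocks d (∈-map⁺ ∀ˢ p) (10th refl)) (go φ)
  go (∃ˢ φ)   = afterStep (λ {d} p → ∈-formulaBlocks d (∈-map⁺ ∃ˢ p) (11th refl)) (go φ)

enumΣ : {B : A → Set} → Enumeration A → (∀ a → Enumeration (B a)) → Enumeration (Σ A B)
enumΣ eA eB .upto d = concatMap (λ a → List.map (a ,_) (eB a .upto d)) (eA .upto d)
enumΣ eA eB .complete (a , b) =
  eventually₂ (λ p q → ∈-concatMap⁺ _ (lose p (∈-map⁺ (a ,_) q)))
    (eA .complete a) (eB a .complete b)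

enum⊎ : Enumeration A → Enumeration B → Enumeration (A ⊎ B)
enum⊎ eA eB .upto d = List.map inj₁ (eA .upto d) ++ List.map inj₂ (eB .upto d)
enum⊎ eA eB .complete (inj₁ a) = eventually₁ (∈-++⁺ˡ ∘ ∈-map⁺ inj₁) (eA .complete a)
enum⊎ eA eB .complete (inj₂ b) = eventually₁ (∈-++⁺ʳ _ ∘ ∈-map⁺ inj₂) (eB .complete b)

-- Conditions

-- An arithmetical formula with parameters; the set parameters are names, i.e. indices of
-- the sequence to be constructed.
record Requirement : Set where
  constructor requirement
  field
    {arity} {setArity} : ℕ
    {formula} : Formula arity setArity
    arith     : Arith formula
    params    : Vec ℕ arity
    names     : Vec ℕ setArity
open Requirement

Fulfils : Sequence → Requirement → Set
Fulfils X c = True (formula c) (toVector (params c)) (env X (names c))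

-- The witness only certifies consistency: the order and the forcing relation look at `requirements`
-- alone.
record Condition : Set where
  field
    requirements : List Requirement
    witness      : Sequence
    consistent   : All (Fulfils witness) requirements
open Condition

_meets_ : Sequence → Condition → Set
X meets p = All (Fulfils X) (requirements p)

record _≼_ (q p : Condition) : Set where
  constructor stronger
  field weaken : ∀ {X} → X meets q → X meets p
open _≼_

≼-refl : ∀ {p} → p ≼ p
≼-refl = stronger id

≼-trans : ∀ {p q r} → r ≼ q → q ≼ p → r ≼ p
≼-trans r≼q q≼p = stronger (weaken q≼p ∘ weaken r≼q)

trivial : Condition
trivial .requirements = []
trivial .witness _ _  = false
trivial .consistent   = []

require : ∀ c p X → Fulfils X c → X meets p → Condition
require c p X f m .requirements = c ∷ requirements p
require c p X f m .witness      = X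
require c p X f m .consistent   = f ∷ m

require-≼ : ∀ {c p X f m} → require c p X f m ≼ p
require-≼ = stronger All.tail

-- Finitely many requirements mention finitely many names, so an initial segment of the sequence
-- settles whether it meets `p`.
meets-bounded : ∀ p → Σ ℕ λ K → ∀ {X Y} → X ≈[ K ] Y → X meets p → Y meets p
meets-bounded p with names-bounded (requirements p)
  where
  names-bounded : ∀ cs → Σ ℕ λ K → All (λ c → BoundedBy K (names c)) cs
  names-bounded []       = 0 , []
  names-bounded (c ∷ cs) with boundedBy (names c) | names-bounded cs
  ... | K , b | L , bs = K ⊔ L , BoundedBy-mono (m≤m⊔n K L) b ∷ All.map (BoundedBy-mono (m≤n⊔m K L)) bs
... | K , bs = K , λ X≈Y fs →
  All.zipWith (λ {c} (b , f) → subst (True (formula c) _) (env-cong-bounded b X≈Y) f) (bs , fs)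

-- Strong forcing.  A conditional is forced by forcing one of the disjuncts ¬φ, ψ, and
-- ∀ is forced as ¬∃¬; with these clauses deciding every formula suffices for genericity.

Neg : (Condition → Set) → Condition → Set
Neg P p = ∀ q → q ≼ p → ¬ P q

Forces : Formula n k → Vec ℕ n → Vec ℕ k → Condition → Set
Forces (t ≈ s)  ρ σ p = evalT t (toVector ρ) ≡ evalT s (toVector ρ)
Forces (t ≺ s)  ρ σ p = evalT t (toVector ρ) < evalT s (toVector ρ)
Forces (t ∈' x) ρ σ p = ∀ X → X meets p → evalT t (toVector ρ) ∈ₛ X (Vec.lookup σ x)
Forces (¬' φ)   ρ σ p = Neg (Forces φ ρ σ) p
Forces (φ ∧' ψ) ρ σ p = Forces φ ρ σ p × Forces ψ ρ σ p
Forces (φ ∨' ψ) ρ σ p = Forces φ ρ σ p ⊎ Forces ψ ρ σ p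
Forces (φ ⇒' ψ) ρ σ p = Neg (Forces φ ρ σ) p ⊎ Forces ψ ρ σ p
Forces (∀ⁿ φ)   ρ σ p = Neg (λ q → Σ ℕ λ m → Neg (Forces φ (m ∷ ρ) σ) q) p
Forces (∃ⁿ φ)   ρ σ p = Σ ℕ λ m → Forces φ (m ∷ ρ) σ p
Forces (∀ˢ φ)   ρ σ p = Neg (λ q → Σ ℕ λ j → Neg (Forces φ ρ (j ∷ σ)) q) p
Forces (∃ˢ φ)   ρ σ p = Σ ℕ λ j → Forces φ ρ (j ∷ σ) p

Monotone : (Condition → Set) → Set
Monotone P = ∀ {p q} → q ≼ p → P p → P q

Neg-mono : ∀ {P} → Monotone (Neg P)
Neg-mono q≼p h r r≼q = h r (≼-trans r≼q q≼p)

Forces-mono : ∀ (φ : Formula n k) {ρ σ} → Monotone (Forces φ ρ σ)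
Forces-mono (t ≈ s)  q≼p h = h
Forces-mono (t ≺ s)  q≼p h = h
Forces-mono (t ∈' x) q≼p h X = h X ∘ weaken q≼p
Forces-mono (¬' φ)   q≼p = Neg-mono q≼p
Forces-mono (φ ∧' ψ) q≼p (h , g) = Forces-mono φ q≼p h , Forces-mono ψ q≼p g
Forces-mono (φ ∨' ψ) q≼p = Sum.map (Forces-mono φ q≼p) (Forces-mono ψ q≼p)
Forces-mono (φ ⇒' ψ) q≼p = Sum.map (Neg-mono q≼p) (Forces-mono ψ q≼p)
Forces-mono (∀ⁿ φ)   q≼p = Neg-mono q≼p
Forces-mono (∃ⁿ φ)   q≼p (m , h) = m , Forces-mono φ q≼p h
Forces-mono (∀ˢ φ)   q≼p = Neg-mono q≼p
Forces-mono (∃ˢ φ)   q≼p (j , h) = j , Forces-mono φ q≼p h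

-- Symmetry of the forcing relation

module _ (π : ℕ → ℕ) (π-involutive : ∀ l → π (π l) ≡ l) where

  private
    map-π-involutive : (σ : Vec ℕ k) → Vec.map π (Vec.map π σ) ≡ σ
    map-π-involutive σ =
      trans (sym (Vec.map-∘ π π σ)) (trans (Vec.map-cong π-involutive σ) (Vec.map-id σ))

  renameNames : Requirement → Requirement
  renameNames c = requirement (arith c) (params c) (Vec.map π (names c))

  Fulfils-renameNames : ∀ X c → Fulfils X (renameNames c) ≡ Fulfils (X ∘ π) c
  Fulfils-renameNames X c =
    cong (True (formula c) (toVector (params c)) ∘ toVector) (sym (Vec.map-∘ X π (names c)))

  renamed : List Requirement → List Requirement
  renamed = List.map renameNames

  All-renamed : ∀ {X} cs → All (Fulfils (X ∘ π)) cs → All (Fulfils X) (renamed cs)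
  All-renamed {X} cs fs = All.map⁺ (All.map (λ {c} → subst id (sym (Fulfils-renameNames X c))) fs)

  All-renamed⁻ : ∀ {X} cs → All (Fulfils X) (renamed cs) → All (Fulfils (X ∘ π)) cs
  All-renamed⁻ {X} cs fs = All.map (λ {c} → subst id (Fulfils-renameNames X c)) (All.map⁻ fs)

  -- `X ∘ π ∘ π` agrees with `X` only pointwise; `meets-bounded` takes the place of extensionality.
  meets-π² : ∀ p {X} → X meets p → (X ∘ π ∘ π) meets p
  meets-π² p {X} = proj₂ (meets-bounded p) (λ _ → cong X (sym (π-involutive _)))

  meets-π²⁻ : ∀ p {X} → (X ∘ π ∘ π) meets p → X meets p
  meets-π²⁻ p {X} = proj₂ (meets-bounded p) (λ _ → cong X (π-involutive _))

  permute : Condition → Condition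
  permute p .requirements = renamed (requirements p)
  permute p .witness      = witness p ∘ π
  permute p .consistent   = All-renamed (requirements p) (meets-π² p (consistent p))

  -- Renaming both sides keeps the order, and renaming `p` twice gives back a condition met by the
  -- same sequences.
  permute-≼ : ∀ {p q} → q ≼ permute p → permute q ≼ p
  permute-≼ {p} {q} q≼πp = stronger λ m →
    meets-π²⁻ p (All-renamed⁻ (requirements p) (weaken q≼πp (All-renamed⁻ (requirements q) m)))

  Neg-permute : ∀ {P Q : Condition → Set} → (∀ {q} → P q → Q (permute q)) →
                ∀ {p} → Neg Q p → Neg P (permute p)
  Neg-permute f h q q≼πp = h (permute q) (permute-≼ q≼πp) ∘ f

  Forces-permute : ∀ (φ : Formula n k) ρ σ {p} →
                   Forces φ ρ σ p → Forces φ ρ (Vec.map π σ) (permute p)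
  -- Negation reverses the direction, so both are proved together. As π is an involution, this one
  -- is the forward direction at the renamed parameters.
  Forces-permute⁻ : ∀ (φ : Formula n k) ρ σ {p} →
                    Forces φ ρ (Vec.map π σ) p → Forces φ ρ σ (permute p)

  Forces-permute (t ≈ s)  ρ σ h = h
  Forces-permute (t ≺ s)  ρ σ h = h
  Forces-permute (t ∈' x) ρ σ {p} h X m rewrite Vec.lookup-map x π σ =
    h (X ∘ π) (All-renamed⁻ (requirements p) m)
  Forces-permute (¬' φ)   ρ σ = Neg-permute (Forces-permute⁻ φ ρ σ)
  Forces-permute (φ ∧' ψ) ρ σ (h , g) = Forces-permute φ ρ σ h , Forces-permute ψ ρ σ g
  Forces-permute (φ ∨' ψ) ρ σ = Sum.map (Forces-permute φ ρ σ) (Forces-permute ψ ρ σ)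
  Forces-permute (φ ⇒' ψ) ρ σ =
    Sum.map (Neg-permute (Forces-permute⁻ φ ρ σ)) (Forces-permute ψ ρ σ)
  Forces-permute (∀ⁿ φ)   ρ σ =
    Neg-permute λ (m , h) → m , Neg-permute (Forces-permute φ (m ∷ ρ) σ) h
  Forces-permute (∃ⁿ φ)   ρ σ (m , h) = m , Forces-permute φ (m ∷ ρ) σ h
  Forces-permute (∀ˢ φ)   ρ σ =
    -- A name `j` for a counterexample becomes `π j`; renaming once more restores `j`.
    Neg-permute λ (j , h) → π j , Neg-permute
      (λ {q} g → subst (λ i → Forces φ ρ (i ∷ _) (permute q)) (π-involutive j)
                   (Forces-permute φ ρ (π j ∷ σ) g)) h
  Forces-permute (∃ˢ φ)   ρ σ (j , h) = π j , Forces-permute φ ρ (j ∷ σ) h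

  Forces-permute⁻ φ ρ σ {p} h =
    subst (λ v → Forces φ ρ v (permute p)) (map-π-involutive σ)
      (Forces-permute φ ρ (Vec.map π σ) h)

-- Swapping names

-- The involution exchanging the block of names below `K` with the next `K` names and fixing all
-- others.
swap : ℕ → ℕ → ℕ
swap K l with l <? K
... | yes _ = K + l
... | no  _ with l <? K + K
...   | yes _ = l ∸ K
...   | no  _ = l

swap-below : ∀ K {l} → l < K → swap K l ≡ K + l
swap-below K {l} l<K with l <? K
... | yes _  = refl
... | no l≮K = ⊥-elim (l≮K l<K)

swap-shifted : ∀ K {l} → l < K → swap K (K + l) ≡ l
swap-shifted K {l} l<K with K + l <? K
... | yes K+l<K = ⊥-elim (m+n≮m K l K+l<K)
... | no  _ with K + l <? K + K
...   | yes _ = m+n∸m≡n K l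
...   | no ¬< = ⊥-elim (¬< (+-monoʳ-< K l<K))

swap-involutive : ∀ K l → swap K (swap K l) ≡ l
swap-involutive K l with l <? K in eq
... | yes l<K = swap-shifted K l<K
... | no  l≮K with l <? K + K in eq′
...   | yes l<K+K = trans (swap-below K (subst (l ∸ K <_) (m+n∸m≡n K K) (∸-monoˡ-< l<K+K (≮⇒≥ l≮K))))
                          (m+[n∸m]≡n (≮⇒≥ l≮K))
-- Here `swap K l` is `l`, so the outer call repeats both tests on `l`, with their recorded
-- outcomes.
...   | no  l≮K+K rewrite eq | eq′ = refl

-- `Y` is shifted up by `K`, and `swap K` brings its first `K` sets back to the front. One sequence
-- thus meets both a condition with names below `K` and its swapped copy.
splice : ℕ → Sequence → Sequence → Sequence
splice K X Y l with l <? K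
... | yes _ = X l
... | no  _ = Y (l ∸ K)

splice-below : ∀ K X Y → X ≈[ K ] splice K X Y
splice-below K X Y {l} l<K with l <? K
... | yes _  = refl
... | no l≮K = ⊥-elim (l≮K l<K)

splice-swap : ∀ K X Y → Y ≈[ K ] (splice K X Y ∘ swap K)
splice-swap K X Y {l} l<K rewrite swap-below K l<K with K + l <? K
... | yes K+l<K = ⊥-elim (m+n≮m K l K+l<K)
... | no  _     = sym (cong Y (m+n∸m≡n K l))

-- Separating a name from another one

-- The language has no equality of sets; disagreement at `n` is written as a negated biconditional
-- of memberships.
differ : ℕ → ℕ → ℕ → Requirement
differ n i j = requirement (a¬ (a∧ (a⇒ ∈₀ ∈₁) (a⇒ ∈₁ ∈₀))) (n ∷ []) (i ∷ j ∷ [])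
  where
  ∈₀ = a∈ (var zero) zero
  ∈₁ = a∈ (var zero) (suc zero)

Fulfils-differ : ∀ X n i j → Fulfils X (differ n i j) ⇔ (X i n ≢ X j n)
Fulfils-differ X n i j =
  (λ f eq → f (trans (sym eq) , trans eq)) ,
  (λ ne (f , g) → ne (agree f g))
  where
  agree : ∀ {b c} → (b ≡ true → c ≡ true) → (c ≡ true → b ≡ true) → b ≡ c
  agree {true}          f g = sym (f refl)
  agree {false} {true}  f g = g refl
  agree {false} {false} f g = refl

-- Such an `r` refutes uniqueness of the solution named `i`. Quantifying the disagreement over all
-- sequences meeting `r` makes it persist to stronger conditions.
Separates : Formula 0 1 → ℕ → Condition → Set
Separates φ i r = Σ ℕ λ j → Forces φ [] (j ∷ []) r × Σ ℕ λ n → ∀ X → X meets r → X i n ≢ X j n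

-- The condition p and its copy under a swap of names have disjoint sets of names, so X can
-- realise the one and Y the other, and the sets named i and π i can differ.
separable : ∀ (φ : Formula 0 1) i p → Forces φ [] (i ∷ []) p →
            ∀ {X Y n} → X meets p → Y meets p → X i n ≢ Y i n →
            Σ Condition λ r → r ≼ p × Separates φ i r
separable φ i p F {X} {Y} {n} mX mY ne with meets-bounded p
... | L , meets-resp = r , r≼p , π i , Forces-mono φ r≼πp (Forces-permute π inv φ [] (i ∷ []) F) ,
                       n , λ Z → proj₁ (Fulfils-differ Z n i (π i)) ∘ All.head
  where
  -- `K` exceeds `i` as well as the names in `p`, so `i` is moved even if it does not occur in `p`.
  K   = suc i ⊔ L
  π   = swap K
  inv = swap-involutive K
  Z   = splice K X Y
  i<K : i < K
  i<K = m≤m⊔n (suc i) L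
  L≤K : L ≤ K
  L≤K = m≤n⊔m (suc i) L
  Z-differs : Z i n ≢ Z (π i) n
  Z-differs eq = ne (trans (cong (λ S → S n) (splice-below K X Y i<K))
                   (trans eq (cong (λ S → S n) (sym (splice-swap K X Y i<K)))))
  πp = permute π inv p
  r : Condition
  r .requirements = differ n i (π i) ∷ requirements p ++ requirements πp
  r .witness      = Z
  r .consistent   = proj₂ (Fulfils-differ Z n i (π i)) Z-differs ∷
    All.++⁺ (meets-resp (λ l<L → splice-below K X Y (<-≤-trans l<L L≤K)) mX)
            (All-renamed π inv (requirements p)
              (meets-resp (λ l<L → splice-swap K X Y (<-≤-trans l<L L≤K)) mY))
  r≼p : r ≼ p
  r≼p = stronger (All.++⁻ˡ (requirements p) ∘ All.tail)
  r≼πp : r ≼ πp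
  r≼πp = stronger (All.++⁻ʳ (requirements p) ∘ All.tail)

-- Determined sets

Determines : Condition → ℕ → Set
Determines p i = ∀ {X Y} → X meets p → Y meets p → X i ≐ Y i

module _ (K : ℕ) where

  -- The extra variable makes the modulus nonzero. Large names wrap around, which is harmless
  -- because `extend` reads every name through the same slot.
  slot : ℕ → Fin (suc K)
  slot l = l mod suc K

  extend : Vec Subset (suc K) → Sequence
  extend v l = toVector v (slot l)

  restrict : Sequence → Vec Subset (suc K)
  restrict X = Vec.tabulate (X ∘ toℕ)

  extend-restrict : ∀ X → X ≈[ suc K ] extend (restrict X)
  extend-restrict X {l} l<K = sym (trans (toVector-lookup (restrict X) (slot l))
    (trans (Vec.lookup∘tabulate (X ∘ toℕ) (slot l))
      (cong X (trans (toℕ-fromℕ< _) (m<n⇒m%n≡m l<K)))))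

  internalise : Requirement → Formula 1 (suc K)
  internalise c = substitute (numeral ∘ Vec.lookup (params c)) (slot ∘ Vec.lookup (names c)) (arith c)

  conjunction : List Requirement → Formula 1 (suc K)
  conjunction []       = zro ≈ zro
  conjunction (c ∷ cs) = internalise c ∧' conjunction cs

  conjunction-arith : ∀ cs → Arith (conjunction cs)
  conjunction-arith []       = a≈ _ _
  conjunction-arith (c ∷ cs) = a∧ (substitute-arith _ _ (arith c)) (conjunction-arith cs)

  True-internalise : ∀ c {ρ} v → True (internalise c) ρ (toVector v) ⇔ Fulfils (extend v) c
  True-internalise c v = True-substitute _ _ (arith c)
    (λ i → trans (evalT-numeral (Vec.lookup (params c) i)) (sym (toVector-lookup (params c) i)))
    (λ j → sym (env-lookup (extend v) (names c) j))

  True-conjunction : ∀ cs {ρ} v → True (conjunction cs) ρ (toVector v) ⇔ All (Fulfils (extend v)) cs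
  True-conjunction []       v = (λ _ → []) , (λ _ → refl)
  True-conjunction (c ∷ cs) v with True-internalise c v | True-conjunction cs v
  ... | to , from | to′ , from′ = (λ (h , g) → to h ∷ to′ g) , (λ { (h ∷ g) → from h , from′ g })

-- Since `p` sees only finitely many names, tuples of sets stand in for sequences, and θ says that a
-- tuple meets `p`. All such tuples agree on the set named `i`; the tuple `v₀` cut from `X` keeps
-- the universal form from being vacuous.
determined-HYP : ∀ p i → Determines p i → ∀ {X} → X meets p → HYP (X i)
determined-HYP p i determined {X} m with meets-bounded p
... | K , meets-resp =
  (∃ˢ* (suc K) (θ ∧' ∈i) , ∃ˢ*-Σ¹₁ (suc K) (σ-arith (a∧ θ-arith ∈i-arith)) , λ n →
    (λ h → proj₂ (True-∃ˢ* (suc K) (θ ∧' ∈i))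
             (v₀ , proj₂ (True-conjunction K _ v₀) m₀ , trans (determined m₀ m n) h)) ,
    (λ h → let v , t , e = proj₁ (True-∃ˢ* (suc K) (θ ∧' ∈i)) h
           in trans (determined m (proj₁ (True-conjunction K _ v) t) n) e)) ,
  (∀ˢ* (suc K) (θ ⇒' ∈i) , ∀ˢ*-Π¹₁ (suc K) (π-arith (a⇒ θ-arith ∈i-arith)) , λ n →
    (λ h → proj₂ (True-∀ˢ* (suc K) (θ ⇒' ∈i)) λ v t →
             trans (determined (proj₁ (True-conjunction K _ v) t) m n) h) ,
    (λ h → trans (determined m m₀ n)
             (proj₁ (True-∀ˢ* (suc K) (θ ⇒' ∈i)) h v₀ (proj₂ (True-conjunction K _ v₀) m₀))))
  where
  θ = conjunction K (requirements p)
  θ-arith = conjunction-arith K (requirements p)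
  ∈i : Formula 1 (suc K)
  ∈i = var zero ∈' slot K i
  ∈i-arith : Arith ∈i
  ∈i-arith = a∈ _ _
  v₀ = restrict K X
  m₀ : extend K v₀ meets p
  m₀ = meets-resp (λ l<K → extend-restrict K X (m<n⇒m<1+n l<K)) m

module Forcing (em : ExcludedMiddle 0ℓ) where

  decidable : {P : Set} → Dec P
  decidable = em

  by-contradiction : {P : Set} → ¬ ¬ P → P
  by-contradiction = decidable-stable em

  -- Forcing and satisfaction

  -- The same `X` still meets the stronger condition, so that a conjunction can be handled by
  -- strengthening twice.
  Attains : Formula n k → Vec ℕ n → Vec ℕ k → Set
  Attains φ ρ σ = ∀ {p X} → X meets p → True φ (toVector ρ) (env X σ) →
                  Σ Condition λ q → q ≼ p × X meets q × Forces φ ρ σ q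

  Sound : Formula n k → Vec ℕ n → Vec ℕ k → Set
  Sound φ ρ σ = ∀ {p X} → Forces φ ρ σ p → X meets p → True φ (toVector ρ) (env X σ)

  -- Once the negation is a requirement, a stronger condition forcing φ would, by soundness, have a
  -- witness satisfying both φ and its negation.
  attains-¬ : {φ : Formula n k} → Arith φ → ∀ {ρ σ} → Sound φ ρ σ → Attains (¬' φ) ρ σ
  attains-¬ a {ρ} {σ} sound {p} {X} m f =
    require (requirement (a¬ a) ρ σ) p X f m , require-≼ , f ∷ m ,
    λ r r≼q F → All.head (weaken r≼q (consistent r)) (sound F (consistent r))

  -- Soundness and attainment are mutually inductive: each uses the other on the subformula of a
  -- negation.
  sound : {φ : Formula n k} → Arith φ → ∀ ρ σ → Sound φ ρ σ
  attains : {φ : Formula n k} → Arith φ → ∀ ρ σ → Attains φ ρ σ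

  sound (a≈ t s) ρ σ F m = F
  sound (a≺ t s) ρ σ F m = F
  sound (a∈ t x) ρ σ {X = X} F m = subst (evalT t _ ∈ₛ_) (sym (env-lookup X σ x)) (F X m)
  sound (a¬ a)   ρ σ F m h =
    let q , q≼p , _ , G = attains a ρ σ m h in F q q≼p G
  sound (a∧ a b) ρ σ (F , G) m = sound a ρ σ F m , sound b ρ σ G m
  sound (a∨ a b) ρ σ (inj₁ F) m = inj₁ (sound a ρ σ F m)
  sound (a∨ a b) ρ σ (inj₂ F) m = inj₂ (sound b ρ σ F m)
  sound (a⇒ a b) ρ σ (inj₁ F) m h =
    let q , q≼p , _ , G = attains a ρ σ m h in ⊥-elim (F q q≼p G)
  sound (a⇒ a b) ρ σ (inj₂ F) m h = sound b ρ σ F m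
  sound (a∀ a)   ρ σ F m x = by-contradiction λ f →
    let q , q≼p , _ , G = attains-¬ a (sound a (x ∷ ρ) σ) m f in F q q≼p (x , G)
  sound (a∃ a)   ρ σ (x , F) m = x , sound a (x ∷ ρ) σ F m

  attains (a≈ t s) ρ σ {p} m h = p , ≼-refl , m , h
  attains (a≺ t s) ρ σ {p} m h = p , ≼-refl , m , h
  attains (a∈ t x) ρ σ {p} {X} m h =
    require (requirement (a∈ t x) ρ σ) p X h m , require-≼ , h ∷ m ,
    λ Y mY → subst (evalT t _ ∈ₛ_) (env-lookup Y σ x) (All.head mY)
  attains (a¬ a)   ρ σ m h = attains-¬ a (sound a ρ σ) m h
  attains (a∧ {φ} a b) ρ σ m (h , g) =
    let q , q≼p , mq , F = attains a ρ σ m h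
        r , r≼q , mr , G = attains b ρ σ mq g
    in r , ≼-trans r≼q q≼p , mr , Forces-mono φ r≼q F , G
  attains (a∨ a b) ρ σ m (inj₁ h) = let q , q≼p , mq , F = attains a ρ σ m h in q , q≼p , mq , inj₁ F
  attains (a∨ a b) ρ σ m (inj₂ h) = let q , q≼p , mq , F = attains b ρ σ m h in q , q≼p , mq , inj₂ F
  attains (a⇒ a b) ρ σ m h with decidable
  ... | yes g = let q , q≼p , mq , F = attains b ρ σ m (h g) in q , q≼p , mq , inj₂ F
  ... | no ¬g = let q , q≼p , mq , F = attains-¬ a (sound a ρ σ) m ¬g in q , q≼p , mq , inj₁ F
  attains (a∀ a)   ρ σ {p} {X} m h =
    -- The universal formula itself becomes a requirement. The witness of any stronger `r` satisfies
    -- every instance, so no instance can be forced false by `r`.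
    require (requirement (a∀ a) ρ σ) p X h m , require-≼ , h ∷ m ,
    λ r r≼q (x , N) →
      let s , s≼r , _ , F = attains a (x ∷ ρ) σ (consistent r) (All.head (weaken r≼q (consistent r)) x)
      in N s s≼r F
  attains (a∃ a)   ρ σ m (x , h) = let q , q≼p , mq , F = attains a (x ∷ ρ) σ m h in q , q≼p , mq , x , F

  _[_↦_] : Sequence → ℕ → Subset → Sequence
  (X [ j ↦ Y ]) l with j ≟ l
  ... | yes _ = Y
  ... | no  _ = X l

  update-self : ∀ X j Y → (X [ j ↦ Y ]) j ≡ Y
  update-self X j Y with j ≟ j
  ... | yes _  = refl
  ... | no j≢j = ⊥-elim (j≢j refl)

  update-below : ∀ X j Y → X ≈[ j ] (X [ j ↦ Y ])
  update-below X j Y {l} l<j with j ≟ l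
  ... | yes j≡l = ⊥-elim (<-irrefl (sym j≡l) l<j)
  ... | no _    = refl

  -- The witness of a set quantifier is given a name not occurring in p or σ.
  attains-Σ¹₁ : {φ : Formula n k} → Σ¹₁ φ → ∀ ρ σ {p X} → X meets p →
                True φ (toVector ρ) (env X σ) → Σ Condition λ q → q ≼ p × Forces φ ρ σ q
  attains-Σ¹₁ (σ-arith a) ρ σ m h = let q , q≼p , _ , F = attains a ρ σ m h in q , q≼p , F
  attains-Σ¹₁ (σ-∃ {φ = φ} s) ρ σ {p} {X} m (Y , h) with boundedBy σ | meets-bounded p
  ... | K , b | L , meets-resp =
    let q , q≼p , F = attains-Σ¹₁ s ρ (j ∷ σ) m′ h′ in q , q≼p , j , F
    where
    j  = K ⊔ L
    X′ = X [ j ↦ Y ]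
    m′ : X′ meets p
    m′ = meets-resp (λ l<L → update-below X j Y (<-≤-trans l<L (m≤n⊔m K L))) m
    h′ : True φ (toVector ρ) (env X′ (j ∷ σ))
    h′ = subst₂ (λ Z τ → True φ (toVector ρ) (Z ∷ᵛ τ)) (sym (update-self X j Y))
           (env-cong-bounded (BoundedBy-mono (m≤m⊔n K L) b) (update-below X j Y)) h

  -- The generic sequence

  -- The second summand is there because separation is not given as a formula of the forcing
  -- language, yet must be decided too.
  Question : Set
  Question = (Σ ℕ λ n → Σ ℕ λ k → Formula n k × Vec ℕ n × Vec ℕ k) ⊎ (Formula 0 1 × ℕ)

  Affirms : Question → Condition → Set
  Affirms (inj₁ (_ , _ , φ , ρ , σ)) = Forces φ ρ σ
  Affirms (inj₂ (φ , i))             = Separates φ i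

  Affirms-mono : ∀ a → Monotone (Affirms a)
  Affirms-mono (inj₁ (_ , _ , φ , ρ , σ)) = Forces-mono φ
  Affirms-mono (inj₂ (φ , i)) q≼p (j , F , n , ne) = j , Forces-mono φ q≼p F , n , λ X → ne X ∘ weaken q≼p

  questions : Enumeration Question
  questions = enum⊎
    (enumΣ enumℕ λ n → enumΣ enumℕ λ k →
      enumΣ (enumFormula n k) λ _ → enumΣ (enumVec enumℕ n) λ _ → enumVec enumℕ k)
    (enumΣ (enumFormula 0 1) λ _ → enumℕ)

  Decides : Condition → Question → Set
  Decides p a = Affirms a p ⊎ Neg (Affirms a) p

  Decides-mono : ∀ {a p q} → q ≼ p → Decides p a → Decides q a
  Decides-mono {a} q≼p = Sum.map (Affirms-mono a q≼p) (Neg-mono q≼p)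

  decide : ∀ a p → Σ Condition λ q → q ≼ p × Decides q a
  decide a p with decidable {Σ Condition λ q → q ≼ p × Affirms a q}
  ... | yes (q , q≼p , h) = q , q≼p , inj₁ h
  ... | no ¬h             = p , ≼-refl , inj₂ λ q q≼p h → ¬h (q , q≼p , h)

  decideAll : ∀ as p → Σ Condition λ q → q ≼ p × All (Decides q) as
  decideAll []       p = p , ≼-refl , []
  decideAll (a ∷ as) p =
    let q , q≼p , d  = decide a p
        r , r≼q , ds = decideAll as q
    in r , ≼-trans r≼q q≼p , Decides-mono {a} r≼q d ∷ ds

  -- Stage `d` settles a finite list of questions at once; as every question is eventually listed,
  -- the chain decides them all.
  generic : ℕ → Condition
  generic zero    = trivial
  generic (suc d) = proj₁ (decideAll (upto questions d) (generic d))

  generic-≼ : ∀ {d e} → d ≤ e → generic e ≼ generic d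
  generic-≼ = go ∘ ≤⇒≤′ where
    go : ∀ {d e} → d ≤′ e → generic e ≼ generic d
    go (≤′-reflexive refl) = ≼-refl
    go (≤′-step {n = e} d≤e) = ≼-trans (proj₁ (proj₂ (decideAll (upto questions e) (generic e)))) (go d≤e)

  generic-⊔ˡ : ∀ d e → generic (d ⊔ e) ≼ generic d
  generic-⊔ˡ d e = generic-≼ (m≤m⊔n d e)

  generic-⊔ʳ : ∀ d e → generic (d ⊔ e) ≼ generic e
  generic-⊔ʳ d e = generic-≼ (m≤n⊔m d e)

  generic-decides : ∀ a → Σ ℕ λ d → Decides (generic d) a
  generic-decides a =
    let N , listed = questions .complete a
    in suc N , All.lookup (proj₂ (proj₂ (decideAll (upto questions N) (generic N)))) (listed N ≤-refl)

  Generically : (Condition → Set) → Set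
  Generically P = Σ ℕ λ d → P (generic d)

  -- The criterion is the forcing clause for membership, made Boolean by excluded middle; the atomic
  -- case of `truth` then holds by construction.
  M : Sequence
  M j n = does (decidable {Generically λ p → ∀ X → X meets p → n ∈ₛ X j})

  ∈-M : ∀ {j n} → (n ∈ₛ M j) ⇔ Generically λ p → ∀ X → X meets p → n ∈ₛ X j
  ∈-M {j} {n} with decidable {Generically λ p → ∀ X → X meets p → n ∈ₛ X j}
  ... | yes h = (λ _ → h) , (λ _ → refl)
  ... | no ¬h = (λ ()) , (λ h → ⊥-elim (¬h h))

  -- Any two conditions in the chain have a common extension in it, which excludes both answers;
  -- every question being decided supplies one of them.
  Generically-Neg : ∀ a → Generically (Neg (Affirms a)) ⇔ (¬ Generically (Affirms a))
  Generically-Neg a = to , from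
    where
    to : Generically (Neg (Affirms a)) → ¬ Generically (Affirms a)
    to (d , N) (e , F) = N (generic (d ⊔ e)) (generic-⊔ˡ d e) (Affirms-mono a (generic-⊔ʳ d e) F)
    from : ¬ Generically (Affirms a) → Generically (Neg (Affirms a))
    from ¬F with generic-decides a
    ... | d , inj₁ F = ⊥-elim (¬F (d , F))
    ... | d , inj₂ N = d , N

  -- Truth in the generic model

  forcing : Formula n k → Vec ℕ n → Vec ℕ k → Question
  forcing φ ρ σ = inj₁ (_ , _ , φ , ρ , σ)

  truth : ∀ (φ : Formula n k) ρ σ →
          Generically (Forces φ ρ σ) ⇔ Sat ℕ M φ (toVector ρ) (env M σ)

  truth-¬ : ∀ (φ : Formula n k) ρ σ →
            Generically (Neg (Forces φ ρ σ)) ⇔ (¬ Sat ℕ M φ (toVector ρ) (env M σ))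
  truth-¬ φ ρ σ with Generically-Neg (forcing φ ρ σ) | truth φ ρ σ
  ... | to , from | to′ , from′ = (λ N → to N ∘ from′) , (λ ¬h → from (¬h ∘ to′))

  truth (t ≈ s)  ρ σ = proj₂ , (0 ,_)
  truth (t ≺ s)  ρ σ = proj₂ , (0 ,_)
  truth (t ∈' x) ρ σ rewrite env-lookup M σ x = proj₂ ∈-M , proj₁ ∈-M
  truth (¬' φ)   ρ σ = truth-¬ φ ρ σ
  truth (φ ∧' ψ) ρ σ with truth φ ρ σ | truth ψ ρ σ
  ... | to , from | to′ , from′ =
    (λ (d , F , G) → to (d , F) , to′ (d , G)) ,
    (λ (h , g) → let d , F = from h ; e , G = from′ g
                 in d ⊔ e , Forces-mono φ (generic-⊔ˡ d e) F , Forces-mono ψ (generic-⊔ʳ d e) G)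
  truth (φ ∨' ψ) ρ σ with truth φ ρ σ | truth ψ ρ σ
  ... | to , from | to′ , from′ =
    (λ { (d , inj₁ F) → inj₁ (to (d , F)) ; (d , inj₂ G) → inj₂ (to′ (d , G)) }) ,
    (λ { (inj₁ h) → let d , F = from h in d , inj₁ F ; (inj₂ g) → let d , G = from′ g in d , inj₂ G })
  truth (φ ⇒' ψ) ρ σ with truth-¬ φ ρ σ | truth ψ ρ σ
  ... | to , from | to′ , from′ =
    (λ { (d , inj₁ N) h → ⊥-elim (to (d , N) h) ; (d , inj₂ G) _ → to′ (d , G) }) , back
    where
    back : _ → Generically (Forces (φ ⇒' ψ) ρ σ)
    back h with decidable
    ... | yes g = let d , G = from′ (h g) in d , inj₂ G
    ... | no ¬g = let d , N = from ¬g in d , inj₁ N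
  -- Forcing `∃ⁿ (¬' φ)` unfolds to exactly the property that the clause for `∀ⁿ` negates.
  truth (∀ⁿ φ)   ρ σ with Generically-Neg (forcing (∃ⁿ (¬' φ)) ρ σ)
  ... | to , from =
    (λ F m → by-contradiction λ ¬h →
       let d , N = proj₂ (truth-¬ φ (m ∷ ρ) σ) ¬h in to F (d , m , N)) ,
    (λ h → from λ (d , m , N) → proj₁ (truth-¬ φ (m ∷ ρ) σ) (d , N) (h m))
  truth (∃ⁿ φ)   ρ σ =
    (λ (d , m , F) → m , proj₁ (truth φ (m ∷ ρ) σ) (d , F)) ,
    (λ (m , h) → let d , F = proj₂ (truth φ (m ∷ ρ) σ) h in d , m , F)
  truth (∀ˢ φ)   ρ σ with Generically-Neg (forcing (∃ˢ (¬' φ)) ρ σ)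
  ... | to , from =
    (λ F j → by-contradiction λ ¬h →
       let d , N = proj₂ (truth-¬ φ ρ (j ∷ σ)) ¬h in to F (d , j , N)) ,
    (λ h → from λ (d , j , N) → proj₁ (truth-¬ φ ρ (j ∷ σ)) (d , N) (h j))
  truth (∃ˢ φ)   ρ σ =
    (λ (d , j , F) → j , proj₁ (truth φ ρ (j ∷ σ)) (d , F)) ,
    (λ (j , h) → let d , F = proj₂ (truth φ ρ (j ∷ σ)) h in d , j , F)

  -- If `M` failed a requirement, its negation would be forced in the chain. The witness of a common
  -- extension fulfils the requirement, so a still stronger condition forces it, a contradiction.
  M-meets-generic : ∀ d → M meets generic d
  M-meets-generic d = All.tabulate λ {c} c∈ → by-contradiction λ ¬f →
    let e , N = proj₂ (truth-¬ (formula c) (params c) (names c)) (¬f ∘ arith-absolute (arith c))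
        p     = generic (d ⊔ e)
        f     = All.lookup (weaken (generic-⊔ˡ d e) (consistent p)) c∈
        q , q≼p , _ , F = attains (arith c) (params c) (names c) {p} (consistent p) f
    in N q (≼-trans q≼p (generic-⊔ʳ d e)) F

  -- The stronger condition `q` forcing φ need not belong to the chain; it suffices that it lies
  -- below one that forces the negation of φ.
  M-isβModel : IsβModel M
  M-isβModel φ s ps = reflect , Σ¹₁-upward s
    where
    σ = Vec.tabulate ps
    env≡ : ∀ j → env M σ j ≡ M (ps j)
    env≡ j = trans (env-lookup M σ j) (cong M (Vec.lookup∘tabulate ps j))
    reflect : True φ []ᵛ (M ∘ ps) → M ⊨ φ [ M ∘ ps ]
    reflect h = Sat-resp ℕ M φ env≡ (by-contradiction λ ¬g →
      let d , N = proj₂ (truth-¬ φ [] σ) ¬g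
          q , q≼p , F = attains-Σ¹₁ s [] σ {generic d} (M-meets-generic d)
                          (Sat-resp Subset id φ (sym ∘ env≡) h)
      in N q q≼p F)

  -- Definable members of the generic model

  definable-determined : ∀ i → DefinableIn M (M i) → Σ ℕ λ d → Determines (generic d) i
  definable-determined i (φ , h , unique)
    with proj₂ (truth φ [] (i ∷ [])) (h) | generic-decides (inj₂ (φ , i))
  -- Since `M` meets every condition in the chain, the forced disagreement is real and contradicts
  -- uniqueness.
  ... | d , F | e , inj₁ (j , G , n , ne) =
    ⊥-elim (ne M (M-meets-generic e) (sym (unique j (proj₁ (truth φ [] (j ∷ [])) (e , G)) n)))
  -- No extension separates, so two sequences that disagree at `i` are impossible by `separable`.
  ... | d , F | e , inj₂ N = d ⊔ e , λ {X} {Y} mX mY n → by-contradiction λ ne →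
    let r , r≼p , S = separable φ i (generic (d ⊔ e)) (Forces-mono φ (generic-⊔ˡ d e) F) mX mY ne
    in N r (≼-trans r≼p (generic-⊔ʳ d e)) S

  definable-HYP : ∀ i → DefinableIn M (M i) → HYP (M i)
  definable-HYP i def =
    let d , determined = definable-determined i def
    in determined-HYP (generic d) i determined (M-meets-generic d)

theorem1p1 : ExcludedMiddle 0ℓ →
    Σ CountableModel λ M →
    IsβModel M × (∀ i → DefinableIn M (M i) → HYP (M i))
theorem1p1 em = M , M-isβModel , definable-HYP
  where open Forcing em
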